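{- Let $A$ be a set of actions. For every star expression $e\in \mathit{StExp}(A)$ it holds that $\underline{\mathcal{C}}(e)_{(\cdot]}$ maps to $\mathcal{C}(e)$ by a functional bisimulation. That is, there is a partial function $f$ from the vertices of the induced chart $\underline{\mathcal{C}}(e)_{(\cdot]}$ of the $1$-chart interpretation $\underline{\mathcal{C}}(e)$ of $e$ to the vertices of the chart interpretation $\mathcal{C}(e)$ of $e$ whose graph is a bisimulation between $\underline{\mathcal{C}}(e)_{(\cdot]}$ and $\mathcal{C}(e)$.
   Context: **Star expressions.** For a set $A$ of actions, the set $\mathit{StExp}(A)$ of star expressions is given by the grammar $e ::= 0 \mid 1 \mid a \mid e_1+e_2 \mid e_1\cdot e_2 \mid e^{*}$ (with $a\in A$). **LTSs.** An LTS (with termination) is a tuple $\langle S,A,\to,\downarrow\rangle$ with $S$ a nonempty set of states, $\to\,\subseteq S\times A\times S$ (written $s\xrightarrow{a}s'$), and $\downarrow\,\subseteq S$ the set of immediately terminating states (written $s{\downarrow}$). A chart is an LTS together with a start vertex $v_{\mathrm s}$, where the set $V$ of states (vertices) is finite. **Process semantics $\mathcal{T}(A)$.** Termination and transitions of star expressions are those derivable by the rules: $1{\downarrow}$; $e_i{\downarrow}\Rightarrow(e_1+e_2){\downarrow}$ ($i\in\{1,2\}$); $e_1{\downarrow},e_2{\downarrow}\Rightarrow(e_1\cdot e_2){\downarrow}$; $(e^*){\downarrow}$; $a\xrightarrow{a}1$; $e_i\xrightarrow{a}e_i'\Rightarrow e_1+e_2\xrightarrow{a}e_i'$ ($i\in\{1,2\}$);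 $e_1\xrightarrow{a}e_1'\Rightarrow e_1\cdot e_2\xrightarrow{a}e_1'\cdot e_2$; $e_1{\downarrow},\,e_2\xrightarrow{a}e_2'\Rightarrow e_1\cdot e_2\xrightarrow{a}e_2'$; $e\xrightarrow{a}e'\Rightarrow e^*\xrightarrow{a}e'\cdot e^*$. This defines the LTS $\mathcal{L}(\mathit{StExp}(A))$ on $\mathit{StExp}(A)$. The chart interpretation $\mathcal{C}(e)$ of $e$ is the sub-LTS of $\mathcal{L}(\mathit{StExp}(A))$ consisting of everything reachable from $e$, with start vertex $e$ (it is known to be finite). **Stacked star expressions.** The set $\mathit{StExp}^{(*)}(A)$ is given by the grammar $E ::= e \mid E\cdot e \mid E\ast e^{*}$ with $e\in\mathit{StExp}(A)$, where $\ast$ is a new binary symbol (stacked product), and $E\cdot e$ for a star expression $E$ is the ordinary star expression product. **Variant semantics $\underline{\mathcal{T}}^{(*)}(A)$.** Let $\underline{A}=A\cup\{1\}$, where the label $1\notin A$ is the empty-step label; $a$ ranges over $A$ and $\underline a$ over $\underline A$; lower-case $e$'s are star expressions, capital $E$'s are stacked star expressions. The rules are: $1{\downarrow}$; $e_i{\downarrow}\Rightarrow(e_1+e_2){\downarrow}$; $e_1{\downarrow},e_2{\downarrow}\Rightarrow(e_1\cdot e_2){\downarrow}$; $(e^*){\downarrow}$; $a\xrightarrow{a}1$; $e_i\xrightarrow{a}E_i'\Rightarrow e_1+e_2\xrightarrow{a}E_i'$; $E_1\xrightarrow{\underline a}E_1'\Rightarrow E_1\cdot e_2\xrightarrow{\underline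 a}E_1'\cdot e_2$; $e_1{\downarrow},\,e_2\xrightarrow{a}E_2'\Rightarrow e_1\cdot e_2\xrightarrow{a}E_2'$; $e\xrightarrow{a}E'\Rightarrow e^*\xrightarrow{a}E'\ast e^*$; $E_1\xrightarrow{\underline a}E_1'\Rightarrow E_1\ast e_2^*\xrightarrow{\underline a}E_1'\ast e_2^*$; $e_1{\downarrow}\Rightarrow e_1\ast e_2^*\xrightarrow{1}e_2^*$. This defines a $1$-LTS (an LTS with labels in $\underline A$) $\underline{\mathcal{L}}(\mathit{StExp}^{(*)}(A))$ on $\mathit{StExp}^{(*)}(A)$. The $1$-chart interpretation $\underline{\mathcal{C}}(e)$ of a star expression $e$ is its part reachable from $e$ (by all transitions, including $1$-transitions), with start vertex $e$. **Induced chart.** The induced chart $\underline{\mathcal{C}}_{(\cdot]}$ of a $1$-chart $\underline{\mathcal{C}}$ has the same vertices and start vertex, and labels in $A$. It has a transition $s\xrightarrow{(a]}s'$ (regarded as an $a$-transition) for $a\in A$ iff $s=s_0\xrightarrow{1}s_1\xrightarrow{1}\cdots\xrightarrow{1}s_n\xrightarrow{a}s'$ in $\underline{\mathcal{C}}$ for some $n\ge 0$. A vertex $s$ terminates (written $s{\downarrow^{(1)}}$) iff $s=s_0\xrightarrow{1}\cdots\xrightarrow{1}s_n$ with $s_n{\downarrow}$ in $\underline{\mathcal{C}}$ for some $n\ge0$. **Bisimulation.** A bisimulation between LTSs $\mathcal L_1,\mathcal L_2$ (with state sets $S_1,S_2$) is a nonempty relation $B\subseteq S_1\times S_2$ such that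 for all $\langle s_1,s_2\rangle\in B$: (forth) if $s_1\xrightarrow{a}s_1'$ then there is $s_2'$ with $s_2\xrightarrow{a}s_2'$ and $\langle s_1',s_2'\rangle\in B$; (back) if $s_2\xrightarrow{a}s_2'$ then there is $s_1'$ with $s_1\xrightarrow{a}s_1'$ and $\langle s_1',s_2'\rangle\in B$; (termination) $s_1{\downarrow}\Leftrightarrow s_2{\downarrow}$. A bisimulation between charts must additionally relate the two start vertices. -}

module Defs where

open import Data.Irrelevant using ([_])
open import Data.Product.Base using (Σ; ∃; ∃-syntax; ∃₂; _×_; _,_)
open import Data.Refinement.Base using (Refinement-syntax; value; _,_)
open import Function.Bundles using (_⇔_)
open import Level using (Level; suc; _⊔_)
open import Relation.Binary.Construct.Closure.ReflexiveTransitive using (Star; ε)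
open import Relation.Binary.Core using (REL; Rel)
open import Relation.Binary.PropositionalEquality.Core using (_≡_)
open import Relation.Unary using (Pred)

private
  variable
    a ℓ : Level

------------------------------------------------------------------------
-- Star expressions and stacked star expressions

-- An expression of kind `star` is an ordinary star expression; one of kind
-- `proper` is a stacked star expression containing at least one stacked
-- product ∗.  Using one family makes E · e, for a star expression E, the very
-- same expression as the ordinary product, as the grammar of stacked
-- expressions demands (a separate embedding constructor would duplicate it).

data Kind : Set where
  star proper : Kind

infixl 6 _⊕_
infixl 7 _·_
infixl 7 _∗[_*]
infix  8 _*

-- The right factor of ∗ is always an iteration:  E ∗[ e *]  is  E ∗ e*.

data Exp (A : Set a) : Kind → Set a where
  𝟘 𝟙     : Exp A star
  act     : A → Exp A star
  _⊕_     : Exp A star → Exp A star → Exp A star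
  _·_     : ∀ {k} → Exp A k → Exp A star → Exp A k
  _*      : Exp A star → Exp A star
  _∗[_*] : ∀ {k} → Exp A k → Exp A star → Exp A proper

StExp : Set a → Set a
StExp A = Exp A star

StExp⁽*⁾ : Set a → Set a
StExp⁽*⁾ A = ∃ λ k → Exp A k

-- A ∪ {1}

data Label₁ (A : Set a) : Set a where
  step₁ : Label₁ A
  step  : A → Label₁ A

------------------------------------------------------------------------
-- Transition system specifications

-- Both specifications have the same termination rules; no rule has a
-- properly stacked expression in its conclusion.

infix 4 _↓

data _↓ {A : Set a} : ∀ {k} → Exp A k → Set a where
  𝟙↓  : 𝟙 ↓
  ⊕↓ˡ : ∀ {e₁ e₂ : StExp A} → e₁ ↓ → e₁ ⊕ e₂ ↓
  ⊕↓ʳ : ∀ {e₁ e₂ : StExp A} → e₂ ↓ → e₁ ⊕ e₂ ↓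
  ·↓  : ∀ {e₁ e₂ : StExp A} → e₁ ↓ → e₂ ↓ → e₁ · e₂ ↓
  *↓  : ∀ {e : StExp A} → e * ↓

infix 4 _-[_]→_

data _-[_]→_ {A : Set a} : StExp A → A → StExp A → Set a where
  act→ : ∀ {a} → act a -[ a ]→ 𝟙
  ⊕→ˡ  : ∀ {e₁ e₂ e′ a} → e₁ -[ a ]→ e′ → e₁ ⊕ e₂ -[ a ]→ e′
  ⊕→ʳ  : ∀ {e₁ e₂ e′ a} → e₂ -[ a ]→ e′ → e₁ ⊕ e₂ -[ a ]→ e′
  ·→ˡ  : ∀ {e₁ e₂ e₁′ a} → e₁ -[ a ]→ e₁′ → e₁ · e₂ -[ a ]→ e₁′ · e₂
  ·→ʳ  : ∀ {e₁ e₂ e₂′ a} → e₁ ↓ → e₂ -[ a ]→ e₂′ → e₁ · e₂ -[ a ]→ e₂′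
  *→   : ∀ {e e′ a} → e -[ a ]→ e′ → e * -[ a ]→ e′ · e *

infix 4 _-[_]⇢_

data _-[_]⇢_ {A : Set a} : ∀ {k k′} → Exp A k → Label₁ A → Exp A k′ → Set a where
  act⇢ : ∀ {a} → act a -[ step a ]⇢ 𝟙
  ⊕⇢ˡ  : ∀ {k′ a} {e₁ e₂ : StExp A} {E′ : Exp A k′} →
         e₁ -[ step a ]⇢ E′ → e₁ ⊕ e₂ -[ step a ]⇢ E′
  ⊕⇢ʳ  : ∀ {k′ a} {e₁ e₂ : StExp A} {E′ : Exp A k′} →
         e₂ -[ step a ]⇢ E′ → e₁ ⊕ e₂ -[ step a ]⇢ E′
  ·⇢ˡ  : ∀ {k k′ α} {E₁ : Exp A k} {E₁′ : Exp A k′} {e₂ : StExp A} →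
         E₁ -[ α ]⇢ E₁′ → E₁ · e₂ -[ α ]⇢ E₁′ · e₂
  ·⇢ʳ  : ∀ {k′ a} {e₁ e₂ : StExp A} {E₂′ : Exp A k′} →
         e₁ ↓ → e₂ -[ step a ]⇢ E₂′ → e₁ · e₂ -[ step a ]⇢ E₂′
  *⇢   : ∀ {k′ a} {e : StExp A} {E′ : Exp A k′} →
         e -[ step a ]⇢ E′ → e * -[ step a ]⇢ E′ ∗[ e *]
  ∗⇢   : ∀ {k k′ α} {E₁ : Exp A k} {E₁′ : Exp A k′} {e₂ : StExp A} →
         E₁ -[ α ]⇢ E₁′ → E₁ ∗[ e₂ *] -[ α ]⇢ E₁′ ∗[ e₂ *]
  ∗⇢₁  : ∀ {e₁ e₂ : StExp A} →
         e₁ ↓ → e₁ ∗[ e₂ *] -[ step₁ ]⇢ e₂ *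

------------------------------------------------------------------------
-- Labelled transition systems

record LTS (L : Set ℓ) : Set (suc ℓ) where
  field
    State    : Set ℓ
    nonempty : State
    Trans    : State → L → State → Set ℓ
    Term     : Pred State ℓ

-- A chart is a rooted LTS with finitely many vertices.  The rooted LTSs
-- formed from star expressions below are known to be finite, and neither
-- reachability, induced transitions nor bisimulations refer to finiteness,
-- so no proof of it is carried along.

record RootedLTS (L : Set ℓ) : Set (suc ℓ) where
  field
    lts   : LTS L
    start : LTS.State lts
  open LTS lts public

module _ {L : Set ℓ} (𝓛 : LTS L) where
  open LTS 𝓛

  Reachable : Rel State ℓ
  Reachable = Star λ s s′ → ∃[ x ] Trans s x s′

  -- Reachability proofs are irrelevant in a Refinement, so that vertices
  -- are equal as soon as the underlying states are.

  reachablePart : State → RootedLTS L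
  reachablePart s₀ = record
    { lts   = record
      { State    = [ s ∈ State ∣ Reachable s₀ s ]
      ; nonempty = s₀ , [ ε ]
      ; Trans    = λ s x s′ → Trans (value s) x (value s′)
      ; Term     = λ s → Term (value s)
      }
    ; start = s₀ , [ ε ]
    }

module _ {A : Set ℓ} (𝓒 : RootedLTS (Label₁ A)) where
  open RootedLTS 𝓒

  induced : RootedLTS A
  induced = record
    { lts   = record
      { State    = State
      ; nonempty = nonempty
      ; Trans    = λ s a s′ → ∃[ t ] Star 1-Trans s t × Trans t (step a) s′
      ; Term     = λ s → ∃[ t ] Star 1-Trans s t × Term t
      }
    ; start = start
    }
    where
    1-Trans : Rel State _
    1-Trans s s′ = Trans s step₁ s′

------------------------------------------------------------------------
-- (1-)chart interpretations

𝓛-StExp : (A : Set a) → LTS A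
𝓛-StExp A = record
  { State    = StExp A
  ; nonempty = 𝟘
  ; Trans    = _-[_]→_
  ; Term     = _↓
  }

𝓛-StExp⁽*⁾ : (A : Set a) → LTS (Label₁ A)
𝓛-StExp⁽*⁾ A = record
  { State    = StExp⁽*⁾ A
  ; nonempty = star , 𝟘
  ; Trans    = λ (_ , E) α (_ , E′) → E -[ α ]⇢ E′
  ; Term     = λ (_ , E) → E ↓
  }

chartInterpretation : {A : Set a} → StExp A → RootedLTS A
chartInterpretation {A = A} e = reachablePart (𝓛-StExp A) e

1-chartInterpretation : {A : Set a} → StExp A → RootedLTS (Label₁ A)
1-chartInterpretation {A = A} e = reachablePart (𝓛-StExp⁽*⁾ A) (star , e)

------------------------------------------------------------------------
-- Functional bisimulations

module _ {L : Set ℓ} where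

  record IsLTSBisimulation (𝓛₁ 𝓛₂ : LTS L)
           (B : REL (LTS.State 𝓛₁) (LTS.State 𝓛₂) ℓ) : Set ℓ where
    private
      module 𝓛₁ = LTS 𝓛₁
      module 𝓛₂ = LTS 𝓛₂
    field
      nonempty    : ∃₂ λ s₁ s₂ → B s₁ s₂
      forth       : ∀ {s₁ s₂ x s₁′} → B s₁ s₂ → 𝓛₁.Trans s₁ x s₁′ →
                    ∃[ s₂′ ] 𝓛₂.Trans s₂ x s₂′ × B s₁′ s₂′
      back        : ∀ {s₁ s₂ x s₂′} → B s₁ s₂ → 𝓛₂.Trans s₂ x s₂′ →
                    ∃[ s₁′ ] 𝓛₁.Trans s₁ x s₁′ × B s₁′ s₂′
      termination : ∀ {s₁ s₂} → B s₁ s₂ → 𝓛₁.Term s₁ ⇔ 𝓛₂.Term s₂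

  record IsBisimulation (𝓒₁ 𝓒₂ : RootedLTS L)
           (B : REL (RootedLTS.State 𝓒₁) (RootedLTS.State 𝓒₂) ℓ) : Set ℓ where
    private
      module 𝓒₁ = RootedLTS 𝓒₁
      module 𝓒₂ = RootedLTS 𝓒₂
    field
      isLTSBisimulation : IsLTSBisimulation 𝓒₁.lts 𝓒₂.lts B
      start             : B 𝓒₁.start 𝓒₂.start
    open IsLTSBisimulation isLTSBisimulation public

-- The domain is an arbitrary, not necessarily decidable, predicate, so this
-- is more general than X → Maybe Y.

record PartialFunction (X Y : Set ℓ) : Set (suc ℓ) where
  field
    Dom          : Pred X ℓ
    apply        : ∀ x → Dom x → Y
    single-value : ∀ {x} (d d′ : Dom x) → apply x d ≡ apply x d′

Graph : {X Y : Set ℓ} → PartialFunction X Y → REL X Y ℓ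
Graph f x y = ∃[ d ] apply x d ≡ y
  where open PartialFunction f

MapsByFunctionalBisimulationTo : {L : Set ℓ} → Rel (RootedLTS L) (suc ℓ)
MapsByFunctionalBisimulationTo 𝓒₁ 𝓒₂ =
  Σ (PartialFunction (RootedLTS.State 𝓒₁) (RootedLTS.State 𝓒₂)) λ f →
    IsBisimulation 𝓒₁ 𝓒₂ (Graph f)

-- Reading every stacked product E ∗ e* as the product E · e* gives a projection
-- π that turns induced transitions and terminations into ordinary ones: the
-- empty step e₁ ∗ e₂* → e₂* for e₁ ↓ is what the rule ·→ʳ does at π (e₁ ∗ e₂*).
-- It is restricted to those vertices whose projection is a vertex of the chart
-- interpretation, as targets of empty steps need not be: b + a* steps to
-- 1 ∗ a* and then emptily to a*, but a* is not reachable from b + a* in 𝓛-StExp.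

{-# OPTIONS --safe #-}
module Submission where

open import Data.Irrelevant using ([_])
open import Data.Product.Base using (∃-syntax; Σ-syntax; _×_; _,_; proj₂)
open import Data.Refinement.Base using (_,_; value)
open import Defs
open import Function.Bundles using (mk⇔)
open import Level using (Level)
open import Relation.Binary.Construct.Closure.ReflexiveTransitive
  using (Star; ε; _◅_; _◅◅_; map; gmap; fold)
open import Relation.Binary.Core using (Rel)
open import Relation.Binary.PropositionalEquality.Core
  using (_≡_; refl; trans; cong)

module _ {a : Level} {A : Set a} where

  private
    variable
      k k′ : Kind
      x : A

  -- Splitting on the kind first makes `π` the identity on star expressions by computation. The
  -- price is that `π (E · e)` is stuck while the kind of `E` is unknown, hence `π-·` and the
  -- rewrites below.
  π : Exp A k → StExp A
  π {k = star}   e            = e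
  π {k = proper} (E · e)      = π E · e
  π {k = proper} (E ∗[ e *])  = π E · e *

  π-· : (E : Exp A k) (e : StExp A) → π (E · e) ≡ π E · e
  π-· {k = star}   E e = refl
  π-· {k = proper} E e = refl

  infix 4 _-1→_ _-1→*_

  _-1→_ : Rel (StExp⁽*⁾ A) a
  (_ , E) -1→ (_ , E′) = E -[ step₁ ]⇢ E′

  _-1→*_ : Rel (StExp⁽*⁾ A) a
  _-1→*_ = Star _-1→_

  ·-1→* : ∀ {E : Exp A k} {E′ : Exp A k′} {e} →
          (k , E) -1→* (k′ , E′) → (k , E · e) -1→* (k′ , E′ · e)
  ·-1→* = gmap (λ (k , E) → k , E · _) ·⇢ˡ

  ∗-1→* : ∀ {E : Exp A k} {E′ : Exp A k′} {e} →
          (k , E) -1→* (k′ , E′) → (proper , E ∗[ e *]) -1→* (proper , E′ ∗[ e *])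
  ∗-1→* = gmap (λ (k , E) → proper , E ∗[ _ *]) ∗⇢

  π-step : {E : Exp A k} {E′ : Exp A k′} → E -[ step x ]⇢ E′ → π E -[ x ]→ π E′
  π-step act⇢           = act→
  π-step (⊕⇢ˡ t)        = ⊕→ˡ (π-step t)
  π-step (⊕⇢ʳ t)        = ⊕→ʳ (π-step t)
  π-step (·⇢ˡ {E₁ = E} {E₁′ = E′} {e₂ = e} t)
    rewrite π-· E e | π-· E′ e = ·→ˡ (π-step t)
  π-step (·⇢ʳ e↓ t)     = ·→ʳ e↓ (π-step t)
  π-step (*⇢ t)         = *→ (π-step t)
  π-step (∗⇢ t)         = ·→ˡ (π-step t)

  π-↓-1→ : {E : Exp A k} {E′ : Exp A k′} → E -[ step₁ ]⇢ E′ → π E′ ↓ → π E ↓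
  π-↓-1→ (·⇢ˡ {E₁ = E} {E₁′ = E′} {e₂ = e} t) d
    rewrite π-· E e | π-· E′ e with d
  ... | ·↓ d₁ d₂               = ·↓ (π-↓-1→ t d₁) d₂
  π-↓-1→ (∗⇢ t) (·↓ d₁ d₂)     = ·↓ (π-↓-1→ t d₁) d₂
  π-↓-1→ (∗⇢₁ e↓) d            = ·↓ e↓ d

  -- Inside a product, the transition may stem from the second factor; then it is termination of the
  -- first that is pulled back, by `π-↓-1→`. The converse fails: at `e₁ ∗[ e₂ *]` the projection may
  -- also move within `e₁`.
  π-→-1→ : ∀ {E : Exp A k} {E′ : Exp A k′} {f} →
           E -[ step₁ ]⇢ E′ → π E′ -[ x ]→ f → π E -[ x ]→ f
  π-→-1→ (·⇢ˡ {E₁ = E} {E₁′ = E′} {e₂ = e} t) u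
    rewrite π-· E e | π-· E′ e with u
  ... | ·→ˡ v                  = ·→ˡ (π-→-1→ t v)
  ... | ·→ʳ d v                = ·→ʳ (π-↓-1→ t d) v
  π-→-1→ (∗⇢ t) (·→ˡ u)        = ·→ˡ (π-→-1→ t u)
  π-→-1→ (∗⇢ t) (·→ʳ d u)      = ·→ʳ (π-↓-1→ t d) u
  π-→-1→ (∗⇢₁ e↓) u            = ·→ʳ e↓ u

  π-↓ : {E : Exp A k} → E ↓ → π E ↓
  π-↓ {k = star} d = d

  -- Stacked products are unwound from the inside out. Ending in a star expression matters: the
  -- premises of `∗⇢₁` and `·⇢ʳ` ask for one that terminates.
  ↓-lift : (E : Exp A k) → π E ↓ → ∃[ e ] (k , E) -1→* (star , e) × e ↓
  ↓-lift {k = star}   e d = e , ε , d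
  ↓-lift {k = proper} (E · e) (·↓ d₁ d₂) =
    let e′ , ts , d = ↓-lift E d₁ in e′ · e , ·-1→* ts , ·↓ d d₂
  ↓-lift {k = proper} (E ∗[ e *]) (·↓ d₁ d₂) =
    let e′ , ts , d = ↓-lift E d₁ in e * , ∗-1→* ts ◅◅ ∗⇢₁ d ◅ ε , d₂

  -- From a star expression no empty steps are needed: the rules of the two semantics match one by
  -- one, and only iteration creates a stacked product, which `π` erases.
  →-lift-star : ∀ {e f : StExp A} → e -[ x ]→ f →
                Σ[ E′ ∈ StExp⁽*⁾ A ] e -[ step x ]⇢ proj₂ E′ × π (proj₂ E′) ≡ f
  →-lift-star act→         = (star , 𝟙) , act⇢ , refl
  →-lift-star (⊕→ˡ t)      = let E′ , u , eq = →-lift-star t in E′ , ⊕⇢ˡ u , eq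
  →-lift-star (⊕→ʳ t)      = let E′ , u , eq = →-lift-star t in E′ , ⊕⇢ʳ u , eq
  →-lift-star (·→ˡ {e₂ = e} t) =
    let (k′ , E′) , u , eq = →-lift-star t
    in (k′ , E′ · e) , ·⇢ˡ u , trans (π-· E′ e) (cong (_· e) eq)
  →-lift-star (·→ʳ e↓ t)   = let E′ , u , eq = →-lift-star t in E′ , ·⇢ʳ e↓ u , eq
  →-lift-star (*→ {e = e} t) =
    let (k′ , E′) , u , eq = →-lift-star t
    in (proper , E′ ∗[ e *]) , *⇢ u , cong (_· e *) eq

  -- A move of the second factor requires the first to terminate, so `↓-lift` first takes that
  -- factor to a terminating star expression.
  →-lift : ∀ (E : Exp A k) {f} → π E -[ x ]→ f →
           Σ[ T ∈ StExp⁽*⁾ A ] (k , E) -1→* T ×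
           Σ[ E′ ∈ StExp⁽*⁾ A ] proj₂ T -[ step x ]⇢ proj₂ E′ × π (proj₂ E′) ≡ f
  →-lift {k = star} e t = (star , e) , ε , →-lift-star t
  →-lift {k = proper} (E · e) (·→ˡ t) =
    let (k″ , T) , ts , (k′ , E′) , u , eq = →-lift E t
    in (k″ , T · e) , ·-1→* ts , (k′ , E′ · e) , ·⇢ˡ u ,
       trans (π-· E′ e) (cong (_· e) eq)
  →-lift {k = proper} (E · e) (·→ʳ d t) =
    let e′ , ts , d′ = ↓-lift E d
        E′ , u , eq  = →-lift-star t
    in (star , e′ · e) , ·-1→* ts , E′ , ·⇢ʳ d′ u , eq
  →-lift {k = proper} (E ∗[ e *]) (·→ˡ t) =
    let (k″ , T) , ts , (k′ , E′) , u , eq = →-lift E t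
    in (proper , T ∗[ e *]) , ∗-1→* ts , (proper , E′ ∗[ e *]) , ∗⇢ u ,
       cong (_· e *) eq
  →-lift {k = proper} (E ∗[ e *]) (·→ʳ d t) =
    let e′ , ts , d′ = ↓-lift E d
        E′ , u , eq  = →-lift-star t
    in (star , e *) , ∗-1→* ts ◅◅ ∗⇢₁ d′ ◅ ε , E′ , u , eq

module _ {ℓ : Level} {L : Set ℓ} (𝓛 : LTS L) {s₀ : LTS.State 𝓛} where
  open LTS 𝓛
  private
    module 𝓡 = RootedLTS (reachablePart 𝓛 s₀)

  -- Each state on the path becomes a vertex by extending `r` along the path so far.
  reachablePart-Star : ∀ {x s t} .(r : Reachable 𝓛 s₀ s) →
                       Star (λ u v → Trans u x v) s t →
                       ∃[ t′ ] value t′ ≡ t × Star (λ u v → 𝓡.Trans u x v) (s , [ r ]) t′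
  reachablePart-Star r ε        = (_ , [ r ]) , refl , ε
  reachablePart-Star r (t ◅ ts) =
    let t′ , eq , us = reachablePart-Star (r ◅◅ (_ , t) ◅ ε) ts in t′ , eq , t ◅ us

theorem5p9 : ∀ {a : Level} (A : Set a) (e : StExp A) →
    MapsByFunctionalBisimulationTo (induced (1-chartInterpretation e)) (chartInterpretation e)
theorem5p9 A e = f , record
  { isLTSBisimulation = record
    { nonempty    = 𝓒₁.start , 𝓒₂.start , ε , refl
    ; forth       = λ {s₁} {_} {_} {s₁′} → forth {s₁} {s₁′ = s₁′}
    ; back        = λ {s₁} → back {s₁}
    ; termination = λ { {s} (_ , refl) → mk⇔ (term⇒ s) (term⇐ s) }
    }
  ; start = ε , refl
  }
  where
  module 𝓒₁ = RootedLTS (induced (1-chartInterpretation e))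
  module 𝓒₂ = RootedLTS (chartInterpretation e)

  π′ : 𝓒₁.State → StExp A
  π′ s = π (proj₂ (value s))

  f : PartialFunction 𝓒₁.State 𝓒₂.State
  f = record
    { Dom          = λ s → Reachable (𝓛-StExp A) e (π′ s)
    ; apply        = λ s r → π′ s , [ r ]
    ; single-value = λ _ _ → refl
    }

  forth : ∀ {s₁ s₂ x s₁′} → Graph f s₁ s₂ → 𝓒₁.Trans s₁ x s₁′ →
          ∃[ s₂′ ] 𝓒₂.Trans s₂ x s₂′ × Graph f s₁′ s₂′
  forth {s₁} {x = x} {s₁′} (r , refl) (_ , ts , t) = _ , u , r ◅◅ (x , u) ◅ ε , refl
    where
    u : π′ s₁ -[ x ]→ π′ s₁′
    -- The pull-back uses `π′` rather than `f`, since vertices between the empty steps may lie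
    -- outside the domain. The target lies inside, as `r` extends by `u`.
    u = fold (λ s t → π′ t -[ x ]→ π′ s₁′ → π′ s -[ x ]→ π′ s₁′)
          (λ t k u → π-→-1→ t (k u)) (λ u → u) ts (π-step t)

  back : ∀ {s₁ s₂ x s₂′} → Graph f s₁ s₂ → 𝓒₂.Trans s₂ x s₂′ →
         ∃[ s₁′ ] 𝓒₁.Trans s₁ x s₁′ × Graph f s₁′ s₂′
  back {(_ , E) , [ r₁ ]} (r , refl) t with →-lift E t
  ... | _ , ts , E′ , u , refl with reachablePart-Star (𝓛-StExp⁽*⁾ A) r₁ ts
  ... | T , refl , us =
    -- Two reachability proofs: in the variant semantics through the empty steps `ts`, and for the
    -- domain of `f` directly by the given transition `t`.
    (E′ , [ r₁ ◅◅ map (_ ,_) ts ◅◅ (_ , u) ◅ ε ]) , (T , us , u) ,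
    r ◅◅ (_ , t) ◅ ε , refl

  term⇒ : ∀ s → 𝓒₁.Term s → π′ s ↓
  term⇒ s (_ , ts , d) =
    fold (λ s t → π′ t ↓ → π′ s ↓) (λ t k d → π-↓-1→ t (k d)) (λ d → d) ts (π-↓ d)

  term⇐ : ∀ s → π′ s ↓ → 𝓒₁.Term s
  term⇐ ((_ , E) , [ r₁ ]) d with ↓-lift E d
  ... | _ , ts , d′ with reachablePart-Star (𝓛-StExp⁽*⁾ A) r₁ ts
  ... | T , refl , us = T , us , d′
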